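{- Let $\nu=\nu_1\nu_2\cdots\nu_{k-1}$ be a word of distinct integers in $[k]$, let $r$ be the unique element of $[k]\setminus\{\nu_1,\ldots,\nu_{k-1}\}$, let $i\in[k-1]$, and let $n\ge 1$. Then: (i) if $\nu_i\notin\mathrm{Lmax}(\nu)$, then $\mathcal{S}_n(\nu;\,r\to\nu_i)=\mathcal{S}_n(\nu_1\cdots\nu_{i-1}\,\overline{r\nu_i}\,\nu_{i+1}\cdots\nu_{k-1})$; (ii) if $r<\max(\nu_1,\ldots,\nu_{i-1})$ (in particular $i\ge 2$), then $\mathcal{S}_n(\nu;\,\nu_i\to r)=\mathcal{S}_n(\nu_1\cdots\nu_{i-1}\,\overline{\nu_i r}\,\nu_{i+1}\cdots\nu_{k-1})$.
   Context: $[n]=\{1,\dots,n\}$, and $\mathcal{S}_n$ is the set of permutations $\pi=\pi_1\pi_2\cdots\pi_n$ of $[n]$ in one-line notation. For a word $w$ of distinct integers, $w_i$ is a left-to-right maximum if $w_i>w_j$ for all $j<i$; $\mathrm{Lmax}(w)$ is the set of all left-to-right maxima of $w$. The permutation $\hat\pi$: for $\pi\in\mathcal{S}_n$, $\hat\pi\in\mathcal{S}_n$ is the permutation whose cycle form is obtained from the word $\pi_1\cdots\pi_n$ by inserting a left parenthesis before each left-to-right maximum and a right parenthesis immediately before the next left-to-right maximum, or at the end of the word. A cycle $(c_1,c_2,\dots,c_s)$ means $c_1\mapsto c_2\mapsto\cdots\mapsto c_s\mapsto c_1$. Example: if $\pi=2537164$ then $\hat\pi=(2)(53)(7164)$. Arrow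 patterns: an arrow pattern of size $k$ is a pair $(\nu;H)$ where $\nu=\nu_1\cdots\nu_m$ is a word of distinct positive integers, $H$ is a collection of arrows $b_i\to c_i$, and the set of all integers appearing in $\nu$ or $H$ is $[k]$. A permutation $\pi\in\mathcal{S}_n$ contains $(\nu;H)$ if there are a set $X=\{x_1<x_2<\cdots<x_k\}\subseteq[n]$ and indices $t_1<\cdots<t_m$ such that $\pi_{t_1}\pi_{t_2}\cdots\pi_{t_m}=x_{\nu_1}x_{\nu_2}\cdots x_{\nu_m}$ and $\hat\pi(x_{b_i})=x_{c_i}$ for every arrow $b_i\to c_i$ in $H$. Otherwise $\pi$ avoids $(\nu;H)$. $\mathcal{S}_n(\nu;H)$ is the set of permutations in $\mathcal{S}_n$ avoiding $(\nu;H)$. Vincular patterns: a vincular pattern is a permutation $\sigma=\sigma_1\cdots\sigma_k$ of $[k]$ in which some adjacent entries are joined by an overline. An occurrence in $\pi$ is a subsequence $\pi_{t_1}\cdots\pi_{t_k}$ ($t_1<\cdots<t_k$) order-isomorphic to $\sigma$ such that entries corresponding to adjacent overlined entries $\sigma_j\sigma_{j+1}$ are consecutive in $\pi$, i.e. $t_{j+1}=t_j+1$. $\mathcal{S}_n(\sigma)$ is the set of permutations in $\mathcal{S}_n$ with no occurrence of $\sigma$. -}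

module Defs where

open import Data.Fin.Base using (Fin; zero; suc; toℕ; fromℕ<; inject₁; punchOut; _<_; _≤_)
open import Data.Fin.Induction using (<-weakInduction)
open import Data.Fin.Permutation using (Permutation′; _⟨$⟩ʳ_; _⟨$⟩ˡ_; inverseˡ; inverseʳ)
open import Data.Fin.Properties as Fin
  using (_≟_; _<?_; any?; all?; toℕ-injective; toℕ-inject₁; punchOut-injective;
         punchIn-punchOut; injective⇒≤)
open import Data.Fin.Subset as Subset using (Subset)
open import Data.List.Base using (List; []; _∷_; take; tabulate)
open import Data.List.Extrema.Nat using (max)
open import Data.List.Relation.Unary.All using (All)
open import Data.List.Relation.Unary.Any using (Any; here)
open import Data.Nat.Base as ℕ using (ℕ; zero; suc)
import Data.Nat.Properties as ℕ
open import Data.Product.Base using (Σ; ∃; _×_; _,_; proj₁; proj₂)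
open import Data.Sum.Base as Sum using (_⊎_; inj₁; inj₂)
open import Data.Vec.Functional using (Vector; insertAt)
open import Data.Vec.Functional.Properties using (insertAt-lookup; insertAt-punchIn)
open import Function.Base using (_∘_)
open import Function.Bundles using (_⇔_; mk⤖)
open import Function.Consequences.Propositional using (strictlySurjective⇒surjective)
open import Function.Definitions using (Injective; StrictlySurjective)
open import Function.Properties.Bijection using (⤖⇒↔)
open import Level using (0ℓ)
open import Relation.Binary.Core using (_Preserves_⟶_)
open import Relation.Binary.Definitions using (tri<; tri≈; tri>)
open import Relation.Binary.PropositionalEquality
  using (_≡_; _≢_; refl; sym; trans; cong; subst)
open import Relation.Nullary using (¬_; Dec; yes; no; contradiction)
open import Relation.Nullary.Decidable using (_×-dec_; _→-dec_; ¬?)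
open import Relation.Unary using (Pred; Decidable)

-- Conventions.  The letters 1, …, n of [n] are the elements 0, …, n - 1 of
-- Fin n, and positions in a word are likewise counted from 0.  A word of
-- length m is a Vector of length m, so its distinctness is injectivity.  The
-- one-line notation of π : Permutation′ n is the word π ⟨$⟩ʳ_, and π ⟨$⟩ˡ x is
-- the position of the letter x.

injective⇒surjective : ∀ {n} {f : Fin n → Fin n} →
                       Injective _≡_ _≡_ f → StrictlySurjective _≡_ f
injective⇒surjective {zero}      _   ()
injective⇒surjective {suc n} {f} inj y with any? (λ x → f x ≟ y)
... | yes hit  = hit
... | no  miss = contradiction (injective⇒≤ {f = g} g-inj) ℕ.1+n≰n
  where
  y≢f : ∀ x → y ≢ f x
  y≢f x y≡fx = miss (x , sym y≡fx)

  g : Fin (suc n) → Fin n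
  g x = punchOut (y≢f x)

  g-inj : Injective _≡_ _≡_ g
  g-inj {a} {b} eq = inj (punchOut-injective (y≢f a) (y≢f b) eq)

fromInjective : ∀ {n} (f : Fin n → Fin n) → Injective _≡_ _≡_ f → Permutation′ n
fromInjective f inj =
  ⤖⇒↔ (mk⤖ {to = f} (inj , strictlySurjective⇒surjective (injective⇒surjective inj)))

IsLRMax : ∀ {m k} → Vector (Fin k) m → Pred (Fin m) 0ℓ
IsLRMax w i = ∀ j → j < i → w j < w i

isLRMax? : ∀ {m k} (w : Vector (Fin k) m) → Decidable (IsLRMax w)
isLRMax? w i = all? (λ j → (j <? i) →-dec (w j <? w i))

Lmax : ∀ {m k} → Vector (Fin k) m → Pred (Fin k) 0ℓ
Lmax w x = ∃ λ i → w i ≡ x × IsLRMax w i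

-- A right parenthesis stands after position t exactly when t has no
-- successor or the successor is a left-to-right maximum.  Continues w t says
-- that there is no such parenthesis.

Continues : ∀ {m k} → Vector (Fin k) m → Pred (Fin m) 0ℓ
Continues w t = ∃ λ u → toℕ u ≡ suc (toℕ t) × ¬ IsLRMax w u

continues? : ∀ {m k} (w : Vector (Fin k) m) → Decidable (Continues w)
continues? w t = any? (λ u → (toℕ u ℕ.≟ suc (toℕ t)) ×-dec ¬? (isLRMax? w u))

-- The left parenthesis of the cycle through position t stands before s.

OpensAt : ∀ {m k} → Vector (Fin k) m → Fin m → Fin m → Set
OpensAt w t s = s ≤ t × IsLRMax w s × (∀ u → s < u → u ≤ t → ¬ IsLRMax w u)

opening : ∀ {m k} (w : Vector (Fin k) m) (t : Fin m) → ∃ (OpensAt w t)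
opening {suc m} w = <-weakInduction (∃ ∘ OpensAt w) base step
  where
  base : ∃ (OpensAt w zero)
  base = zero , ℕ.z≤n , (λ _ ()) , λ u 0<u u≤0 _ → ℕ.<⇒≱ 0<u u≤0

  step : ∀ t → ∃ (OpensAt w (inject₁ t)) → ∃ (OpensAt w (suc t))
  step t (s , s≤t , s-max , last) with isLRMax? w (suc t)
  ... | yes max = suc t , ℕ.≤-refl , max , λ u lt ge _ → ℕ.<⇒≱ lt ge
  ... | no ¬max = s , ℕ.m≤n⇒m≤1+n s≤t′ , s-max , last′
    where
    s≤t′ : toℕ s ℕ.≤ toℕ t
    s≤t′ = subst (toℕ s ℕ.≤_) (toℕ-inject₁ t) s≤t

    last′ : ∀ u → s < u → u ≤ suc t → ¬ IsLRMax w u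
    last′ u s<u u≤1+t with ℕ.m≤n⇒m<n∨m≡n u≤1+t
    ... | inj₁ u<1+t = last u s<u (subst (toℕ u ℕ.≤_) (sym (toℕ-inject₁ t)) (ℕ.s≤s⁻¹ u<1+t))
    ... | inj₂ u≡1+t = subst (¬_ ∘ IsLRMax w) (sym (toℕ-injective u≡1+t)) ¬max

-- The map on positions described by the cycle form: a letter goes to the next
-- letter of the word, except that the last letter of a cycle goes to the
-- first letter of that cycle.

cycleStep′ : ∀ {m k} (w : Vector (Fin k) m) (t : Fin m) → Dec (Continues w t) → Fin m
cycleStep′ w t (yes (u , _)) = u
cycleStep′ w t (no _)        = proj₁ (opening w t)

cycleStep : ∀ {m k} → Vector (Fin k) m → Fin m → Fin m
cycleStep w t = cycleStep′ w t (continues? w t)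

cycleStep-injective : ∀ {m k} (w : Vector (Fin k) m) → Injective _≡_ _≡_ (cycleStep w)
cycleStep-injective w {a} {b} with continues? w a | continues? w b
... | yes (_ , u≡1+a , _) | yes (_ , v≡1+b , _) = λ u≡v →
  toℕ-injective (ℕ.suc-injective (trans (sym u≡1+a) (trans (cong toℕ u≡v) v≡1+b)))
... | yes (_ , _ , ¬max) | no _ = λ u≡s →
  contradiction (subst (IsLRMax w) (sym u≡s) (proj₁ (proj₂ (proj₂ (opening w b))))) ¬max
... | no _ | yes (_ , _ , ¬max) = λ s≡u →
  contradiction (subst (IsLRMax w) s≡u (proj₁ (proj₂ (proj₂ (opening w a))))) ¬max
... | no ¬a→ | no ¬b→ = λ s≡s′ → sameCycle (opening w a) (opening w b) s≡s′
  where
  -- If the cycle through c and d opens at s and c < d, then c + 1 lies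
  -- inside that cycle.
  inside : ∀ {c d s} → OpensAt w c s → OpensAt w d s → c < d → Continues w c
  inside {c} {d} {s} (s≤c , _) (_ , _ , last) c<d =
    u , u≡1+c , last u s<u u≤d
    where
    1+c<m : suc (toℕ c) ℕ.< _
    1+c<m = ℕ.≤-<-trans c<d (Fin.toℕ<n d)
    u = fromℕ< 1+c<m
    u≡1+c : toℕ u ≡ suc (toℕ c)
    u≡1+c = Fin.toℕ-fromℕ< 1+c<m
    s<u : s < u
    s<u = subst (toℕ s ℕ.<_) (sym u≡1+c) (ℕ.s≤s s≤c)
    u≤d : u ≤ d
    u≤d = subst (ℕ._≤ toℕ d) (sym u≡1+c) c<d

  sameCycle : (o : ∃ (OpensAt w a)) (o′ : ∃ (OpensAt w b)) → proj₁ o ≡ proj₁ o′ → a ≡ b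
  sameCycle (s , oa) (.s , ob) refl with Fin.<-cmp a b
  ... | tri< a<b _ _ = contradiction (inside oa ob a<b) ¬a→
  ... | tri≈ _ a≡b _ = a≡b
  ... | tri> _ _ b<a = contradiction (inside ob oa b<a) ¬b→

hatFun : ∀ {n} → Permutation′ n → Fin n → Fin n
hatFun π x = π ⟨$⟩ʳ cycleStep (π ⟨$⟩ʳ_) (π ⟨$⟩ˡ x)

hatFun-injective : ∀ {n} (π : Permutation′ n) → Injective _≡_ _≡_ (hatFun π)
hatFun-injective π eq =
  from-inj (cycleStep-injective (π ⟨$⟩ʳ_) (to-inj eq))
  where
  to-inj : Injective _≡_ _≡_ (π ⟨$⟩ʳ_)
  to-inj p = trans (sym (inverseˡ π)) (trans (cong (π ⟨$⟩ˡ_) p) (inverseˡ π))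
  from-inj : Injective _≡_ _≡_ (π ⟨$⟩ˡ_)
  from-inj p = trans (sym (inverseʳ π)) (trans (cong (π ⟨$⟩ʳ_) p) (inverseʳ π))

hat : ∀ {n} → Permutation′ n → Permutation′ n
hat π = fromInjective (hatFun π) (hatFun-injective π)

-- (b , c) in arrows stands for b → c.

record ArrowPattern (k : ℕ) : Set where
  field
    {size}   : ℕ
    word     : Vector (Fin k) size
    distinct : Injective _≡_ _≡_ word
    arrows   : List (Fin k × Fin k)
    covers   : ∀ a → (∃ λ j → word j ≡ a) ⊎ Any (λ (b , c) → a ≡ b ⊎ a ≡ c) arrows

-- The increasing function x enumerates the set X of the definition.

ContainsArrow : ∀ {n k} → ArrowPattern k → Pred (Permutation′ n) 0ℓ
ContainsArrow {n} {k} p π =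
  Σ (Fin k → Fin n) λ x → Σ (Fin size → Fin n) λ t →
    x Preserves _<_ ⟶ _<_ ×
    t Preserves _<_ ⟶ _<_ ×
    (∀ j → π ⟨$⟩ʳ t j ≡ x (word j)) ×
    All (λ (b , c) → hat π ⟨$⟩ʳ x b ≡ x c) arrows
  where open ArrowPattern p

𝒮ᵃ : ∀ n {k} → ArrowPattern k → Pred (Permutation′ n) 0ℓ
𝒮ᵃ n p π = ¬ ContainsArrow p π

-- A vincular pattern of size suc m.  Its adjacent positions are the pairs
-- (inject₁ j , suc j) for j : Fin m, and j ∈ overlined says that the entries
-- at these two positions are joined by an overline.

record VincularPattern (m : ℕ) : Set where
  field
    word      : Vector (Fin (suc m)) (suc m)
    distinct  : Injective _≡_ _≡_ word
    overlined : Subset m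

OrderIsomorphic : ∀ {m k l} → Vector (Fin k) m → Vector (Fin l) m → Set
OrderIsomorphic v w = ∀ a b → v a < v b ⇔ w a < w b

ContainsVincular : ∀ {n m} → VincularPattern m → Pred (Permutation′ n) 0ℓ
ContainsVincular {n} {m} σ π =
  Σ (Fin (suc m) → Fin n) λ t →
    t Preserves _<_ ⟶ _<_ ×
    OrderIsomorphic word (λ a → π ⟨$⟩ʳ t a) ×
    (∀ j → j Subset.∈ overlined → toℕ (t (suc j)) ≡ suc (toℕ (t (inject₁ j))))
  where open VincularPattern σ

𝒮ᵛ : ∀ n {m} → VincularPattern m → Pred (Permutation′ n) 0ℓ
𝒮ᵛ n σ π = ¬ ContainsVincular σ π

-- The maximum of the letters before position i, as a natural number.  If there
-- are none it is 0, and then no letter is smaller than it.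

maxBefore : ∀ {m k} → Vector (Fin k) m → Fin m → ℕ
maxBefore w i = max 0 (take (toℕ i) (tabulate (toℕ ∘ w)))

insertAt-other : ∀ {m k} (ν : Vector (Fin k) m) p r {c} (p≢c : p ≢ c) →
                 insertAt ν p r c ≡ ν (punchOut p≢c)
insertAt-other ν p r p≢c =
  trans (cong (insertAt ν p r) (sym (punchIn-punchOut p≢c))) (insertAt-punchIn ν p r _)

insertAt-injective : ∀ {m k} {ν : Vector (Fin k) m} {r : Fin k} →
                     Injective _≡_ _≡_ ν → (∀ j → ν j ≢ r) →
                     ∀ p → Injective _≡_ _≡_ (insertAt ν p r)
insertAt-injective {ν = ν} {r} ν-inj r∉ν p {a} {b} eq with p ≟ a | p ≟ b
... | yes refl | yes refl = refl
... | yes refl | no p≢b   = contradiction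
  (trans (sym (insertAt-other ν p r p≢b)) (trans (sym eq) (insertAt-lookup ν p r))) (r∉ν _)
... | no p≢a   | yes refl = contradiction
  (trans (sym (insertAt-other ν p r p≢a)) (trans eq (insertAt-lookup ν p r))) (r∉ν _)
... | no p≢a   | no p≢b   = punchOut-injective p≢a p≢b
  (ν-inj (trans (sym (insertAt-other ν p r p≢a)) (trans eq (insertAt-other ν p r p≢b))))

missing-unique : ∀ {m} {ν : Vector (Fin (suc m)) m} {r : Fin (suc m)} →
                 Injective _≡_ _≡_ ν → (∀ j → ν j ≢ r) →
                 ∀ a → (∃ λ j → ν j ≡ a) ⊎ a ≡ r
missing-unique ν-inj r∉ν a with injective⇒surjective (insertAt-injective ν-inj r∉ν zero) a
... | zero  , r≡a  = inj₂ (sym r≡a)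
... | suc j , νj≡a = inj₁ (j , νj≡a)

-- (ν ; b → c) for a word ν whose only missing letter r is b or c.

oneArrow : ∀ {m} (ν : Vector (Fin (suc m)) m) {r : Fin (suc m)} →
           Injective _≡_ _≡_ ν → (∀ j → ν j ≢ r) →
           (b c : Fin (suc m)) → r ≡ b ⊎ r ≡ c → ArrowPattern (suc m)
oneArrow ν ν-inj r∉ν b c r∈bc = record
  { word     = ν
  ; distinct = ν-inj
  ; arrows   = (b , c) ∷ []
  ; covers   = λ a → Sum.map₂ (λ { refl → here r∈bc }) (missing-unique ν-inj r∉ν a)
  }

-- The word obtained from ν by inserting r at position inject₁ i (just before
-- ν i) or suc i (just after ν i); in both cases the overline joins the
-- positions inject₁ i and suc i.

overlineBefore : ∀ {m} (ν : Vector (Fin (suc m)) m) (r : Fin (suc m)) →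
                 Injective _≡_ _≡_ ν → (∀ j → ν j ≢ r) → Fin m → VincularPattern m
overlineBefore ν r ν-inj r∉ν i = record
  { word      = insertAt ν (inject₁ i) r
  ; distinct  = insertAt-injective ν-inj r∉ν (inject₁ i)
  ; overlined = Subset.⁅ i ⁆
  }

overlineAfter : ∀ {m} (ν : Vector (Fin (suc m)) m) (r : Fin (suc m)) →
                Injective _≡_ _≡_ ν → (∀ j → ν j ≢ r) → Fin m → VincularPattern m
overlineAfter ν r ν-inj r∉ν i = record
  { word      = insertAt ν (suc i) r
  ; distinct  = insertAt-injective ν-inj r∉ν (suc i)
  ; overlined = Subset.⁅ i ⁆
  }

{-# OPTIONS --safe #-}

-- If a letter larger than π s′ stands at or before position s or s′, then s′ is
-- not the opening left-to-right maximum of the cycle through s, because that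
-- maximum dominates every letter up to s.  Hence π̂ sends π s to π s′ exactly
-- when s′ = s + 1.  The hypotheses of (i) and (ii) each provide such a letter
-- among ν₁, …, νᵢ₋₁, so in both cases the arrow amounts to adjacency.

module Submission where

open import Defs
open import Data.Fin.Base as Fin using (Fin; zero; suc; toℕ; inject₁; punchIn)
open import Data.Fin.Induction using (<-wellFounded)
open import Data.Fin.Permutation using (Permutation′; _⟨$⟩ʳ_; _⟨$⟩ˡ_; inverseˡ; inverseʳ)
open import Data.Fin.Properties as Fin
  using (toℕ-injective; toℕ-inject₁; any?; ¬∀⟶∃¬; punchIn-mono-≤; punchIn-injective)
open import Data.Fin.Subset using (⁅_⁆)
open import Data.Fin.Subset.Properties using (x∈⁅x⁆; x∈⁅y⁆⇒x≡y)
open import Data.List.Base using (take; tabulate)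
open import Data.List.Extrema.Nat using (max≤v⁺)
open import Data.List.Relation.Unary.All using (All; []; _∷_)
open import Data.Nat.Base as ℕ using (ℕ; zero; suc; _<_; _≥_; z≤n; s≤s; s<s; s<s⁻¹; s≤s⁻¹)
import Data.Nat.Properties as ℕ
open import Data.Product.Base using (∃; _×_; _,_; proj₁; proj₂)
open import Data.Sum.Base using (_⊎_; inj₁; inj₂; [_,_]′)
open import Data.Vec.Functional using (Vector; insertAt)
open import Data.Vec.Functional.Properties using (insertAt-lookup; insertAt-punchIn)
open import Function.Base using (_∘_; id)
open import Function.Bundles using (mk⇔; Equivalence)
open import Function.Definitions using (Injective)
open import Induction.WellFounded using (Acc; acc)
open import Relation.Binary.Core using (_Preserves_⟶_)
open import Relation.Binary.Definitions using (tri<; tri≈; tri>)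
open import Relation.Binary.PropositionalEquality
  using (_≡_; _≢_; refl; sym; trans; cong; subst; subst₂; module ≡-Reasoning)
open import Relation.Nullary using (¬_; yes; no; contradiction)
open import Relation.Nullary.Decidable using (_×-dec_; _→-dec_)
open import Relation.Unary using (_∉_; _≐_)

-- Increasing position maps and the insertion of one more position.

Increasing : ∀ {m n} → Vector (Fin n) m → Set
Increasing t = t Preserves Fin._<_ ⟶ Fin._<_

module _ {m n} {t : Vector (Fin n) m} (t-inc : Increasing t) where

  increasing⇒monotone : t Preserves Fin._≤_ ⟶ Fin._≤_
  increasing⇒monotone {a} {b} a≤b with ℕ.m≤n⇒m<n∨m≡n a≤b
  ... | inj₁ a<b = ℕ.<⇒≤ (t-inc a<b)
  ... | inj₂ a≡b = ℕ.≤-reflexive (cong (toℕ ∘ t) (toℕ-injective a≡b))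

  increasing⇒reflects-< : ∀ {a b} → t a Fin.< t b → a Fin.< b
  increasing⇒reflects-< ta<tb = ℕ.≰⇒> (ℕ.<⇒≱ ta<tb ∘ increasing⇒monotone)

  increasing⇒injective : Injective _≡_ _≡_ t
  increasing⇒injective {a} {b} ta≡tb with Fin.<-cmp a b
  ... | tri< a<b _ _ = contradiction ta≡tb (Fin.<⇒≢ (t-inc a<b))
  ... | tri≈ _ a≡b _ = a≡b
  ... | tri> _ _ b<a = contradiction (sym ta≡tb) (Fin.<⇒≢ (t-inc b<a))

punchIn-increasing : ∀ {m} (p : Fin (suc m)) → Increasing (punchIn p)
punchIn-increasing p {j} {k} j<k =
  Fin.≤∧≢⇒< (punchIn-mono-≤ p j k (ℕ.<⇒≤ j<k)) (Fin.<⇒≢ j<k ∘ punchIn-injective p j k)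

punchIn-inject₁ : ∀ {m} (i : Fin m) → punchIn (inject₁ i) i ≡ suc i
punchIn-inject₁ zero    = refl
punchIn-inject₁ (suc i) = cong suc (punchIn-inject₁ i)

punchIn-suc : ∀ {m} (i : Fin m) → punchIn (suc i) i ≡ inject₁ i
punchIn-suc zero    = refl
punchIn-suc (suc i) = cong suc (punchIn-suc i)

insertAt-inject₁-suc : ∀ {a} {A : Set a} {m} (t : Vector A m) i u →
                       insertAt t (inject₁ i) u (suc i) ≡ t i
insertAt-inject₁-suc t i u = trans (cong (insertAt t (inject₁ i) u) (sym (punchIn-inject₁ i)))
  (insertAt-punchIn t (inject₁ i) u i)

insertAt-suc-inject₁ : ∀ {a} {A : Set a} {m} (t : Vector A m) i u →
                       insertAt t (suc i) u (inject₁ i) ≡ t i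
insertAt-suc-inject₁ t i u = trans (cong (insertAt t (suc i) u) (sym (punchIn-suc i)))
  (insertAt-punchIn t (suc i) u i)

insertAt-all : ∀ {a} {A : Set a} {P : A → Set} {m} (t : Vector A m) p {u} →
               P u → (∀ j → P (t j)) → ∀ k → P (insertAt t p u k)
insertAt-all t zero    pu pt zero    = pu
insertAt-all t zero    pu pt (suc k) = pt k
insertAt-all {m = suc _} t (suc p) pu pt zero    = pt zero
insertAt-all {P = P} {m = suc _} t (suc p) pu pt (suc k) =
  insertAt-all {P = P} (t ∘ suc) p pu (pt ∘ suc) k

insertAt-increasing : ∀ {m n} {t : Vector (Fin n) m} {u} p → Increasing t →
                      (∀ j → j Fin.< p → t j Fin.< u) → (∀ j → p Fin.≤ j → u Fin.< t j) →
                      Increasing (insertAt t p u)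
insertAt-increasing zero t-inc below above {zero}  {suc b} a<b = above b z≤n
insertAt-increasing zero t-inc below above {suc a} {suc b} a<b = t-inc (s<s⁻¹ a<b)
insertAt-increasing {suc m} {t = t} (suc p) t-inc below above {zero} {suc b} a<b =
  insertAt-all {P = t zero Fin.<_} (t ∘ suc) p
    (below zero ℕ.z<s) (λ j → t-inc ℕ.z<s) b
insertAt-increasing {suc m} (suc p) t-inc below above {suc a} {suc b} a<b =
  insertAt-increasing p (t-inc ∘ s<s)
    (λ j → below (suc j) ∘ s<s) (λ j → above (suc j) ∘ s≤s) (s<s⁻¹ a<b)

-- The overline joins the positions `inject₁ i` and `suc i`. The missing letter takes one of them
-- and `ν i` the other, so the two values of `p` are parts (i) and (ii), treated together from here
-- on.
NextTo : ∀ {m} → Fin m → Fin (suc m) → Set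
NextTo i p = p ≡ inject₁ i ⊎ p ≡ suc i

punchIn-nextTo : ∀ {m} {i : Fin m} {p} → NextTo i p → NextTo i (punchIn p i)
punchIn-nextTo (inj₁ refl) = inj₂ (punchIn-inject₁ _)
punchIn-nextTo (inj₂ refl) = inj₁ (punchIn-suc _)

-- The adjacency makes `u` the immediate neighbour of `t i`, so no value lies strictly between the
-- two. As `t` avoids `u`, every other value of `t` is then on the correct side of `u`.
insertAt-nextTo-increasing :
  ∀ {m n} {t : Vector (Fin n) m} {u i p} → NextTo i p → Increasing t → (∀ j → t j ≢ u) →
  toℕ (insertAt t p u (suc i)) ≡ suc (toℕ (insertAt t p u (inject₁ i))) →
  Increasing (insertAt t p u)
insertAt-nextTo-increasing {t = t} {u} {i} (inj₁ refl) t-inc u∉t adj =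
  insertAt-increasing (inject₁ i) t-inc below above
  where
  ti≡1+u : toℕ (t i) ≡ suc (toℕ u)
  ti≡1+u = subst₂ (λ a b → toℕ a ≡ suc (toℕ b))
    (insertAt-inject₁-suc t i u) (insertAt-lookup t (inject₁ i) u) adj

  below : ∀ j → j Fin.< inject₁ i → t j Fin.< u
  -- From `t j < t i = u + 1` follows only `t j ≤ u`; `u∉t` makes it strict.
  below j j<i = Fin.≤∧≢⇒<
    (s≤s⁻¹ (subst (toℕ (t j) <_) ti≡1+u (t-inc (subst (toℕ j <_) (toℕ-inject₁ i) j<i))))
    (u∉t j)

  above : ∀ j → inject₁ i Fin.≤ j → u Fin.< t j
  above j i≤j = ℕ.≤-trans (ℕ.≤-reflexive (sym ti≡1+u))
    (increasing⇒monotone t-inc (subst (ℕ._≤ toℕ j) (toℕ-inject₁ i) i≤j))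
insertAt-nextTo-increasing {t = t} {u} {i} (inj₂ refl) t-inc u∉t adj =
  insertAt-increasing (suc i) t-inc below above
  where
  u≡1+ti : toℕ u ≡ suc (toℕ (t i))
  u≡1+ti = subst₂ (λ a b → toℕ a ≡ suc (toℕ b))
    (insertAt-lookup t (suc i) u) (insertAt-suc-inject₁ t i u) adj

  below : ∀ j → j Fin.< suc i → t j Fin.< u
  below j j<1+i = ℕ.≤-trans (s≤s (increasing⇒monotone t-inc (s≤s⁻¹ j<1+i)))
    (ℕ.≤-reflexive (sym u≡1+ti))

  above : ∀ j → suc i Fin.≤ j → u Fin.< t j
  above j i<j = Fin.≤∧≢⇒<
    (subst (ℕ._≤ toℕ (t j)) (sym u≡1+ti) (t-inc i<j)) (u∉t j ∘ sym)

-- Left-to-right maxima and the cycle through a position.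

module _ {m k} (w : Vector (Fin k) m) where

  -- Over a finite set of positions a failed decidable universal statement has a counterexample. The
  -- bound is weak because `w` may repeat letters.
  ¬IsLRMax⇒∃≥ : ∀ {i} → ¬ IsLRMax w i → ∃ λ j → j Fin.< i × w i Fin.≤ w j
  ¬IsLRMax⇒∃≥ {i} ¬max
    with ¬∀⟶∃¬ m _ (λ j → (j Fin.<? i) →-dec (w j Fin.<? w i)) ¬max
  ... | j , ¬imp with j Fin.<? i
  ... | yes j<i = j , j<i , ℕ.≮⇒≥ (λ lt → ¬imp (λ _ → lt))
  ... | no j≮i  = contradiction (λ j<i → contradiction j<i j≮i) ¬imp

  -- Well-founded descent on `v`: a position after `s` in the cycle is no left-to-right maximum, so
  -- an earlier position carries a letter at least as large. The descent ends at `s` or before it,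
  -- where `s-max` applies.
  opening-max : ∀ {s t} → OpensAt w t s → ∀ {v} → v Fin.≤ t → w v Fin.≤ w s
  opening-max {s} {t} (s≤t , s-max , last) = go (<-wellFounded _)
    where
    go : ∀ {v} → Acc Fin._<_ v → v Fin.≤ t → w v Fin.≤ w s
    go {v} (acc rec) v≤t with Fin.<-cmp v s
    ... | tri< v<s _ _ = ℕ.<⇒≤ (s-max v v<s)
    ... | tri≈ _ refl _ = ℕ.≤-refl
    ... | tri> _ _ s<v with ¬IsLRMax⇒∃≥ (last v s<v v≤t)
    ... | j , j<v , wv≤wj = ℕ.≤-trans wv≤wj (go (rec j<v) (ℕ.≤-trans (ℕ.<⇒≤ j<v) v≤t))

  module _ {s s′ v : Fin m} (ws′<wv : w s′ Fin.< w v) (v≤ : v Fin.≤ s ⊎ v Fin.≤ s′) where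

    cycleStep≡⇒adjacent : cycleStep w s ≡ s′ → toℕ s′ ≡ suc (toℕ s)
    cycleStep≡⇒adjacent eq with continues? w s
    cycleStep≡⇒adjacent refl | yes (_ , adj , _) = adj
    -- Here `s′` is the opening of the cycle through `s`, so its letter would be at least `w v`.
    cycleStep≡⇒adjacent refl | no _ =
      contradiction (opening-max opens v≤s) (ℕ.<⇒≱ ws′<wv)
      where
      opens = proj₂ (opening w s)

      -- An opening never lies after `s`, so a bound by `s′` is also a bound by `s`.
      v≤s : v Fin.≤ s
      v≤s = [ id , (λ v≤s′ → ℕ.≤-trans v≤s′ (proj₁ opens)) ]′ v≤

    adjacent⇒cycleStep≡ : toℕ s′ ≡ suc (toℕ s) → cycleStep w s ≡ s′
    adjacent⇒cycleStep≡ adj with continues? w s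
    ... | yes (_ , adj′ , _) = toℕ-injective (trans adj′ (sym adj))
    -- The larger letter at `v` stands strictly before `s′`, so no cycle opens at `s′` and `s` must
    -- continue.
    ... | no ¬continues = contradiction (s′ , adj , ¬max) ¬continues
      where
      v≤s′ : v Fin.≤ s′
      v≤s′ = [ (λ v≤s → ℕ.≤-trans v≤s (ℕ.<⇒≤ (ℕ.≤-reflexive (sym adj)))) , id ]′ v≤

      ¬max : ¬ IsLRMax w s′
      ¬max s′-max = ℕ.<-asym ws′<wv
        (s′-max v (Fin.≤∧≢⇒< v≤s′ λ v≡s′ → Fin.<⇒≢ ws′<wv (cong w (sym v≡s′))))

-- From positions to letters.

module _ {n} (π : Permutation′ n) where

  private
    w : Vector (Fin n) n
    w = π ⟨$⟩ʳ_

  permutation-injective : Injective _≡_ _≡_ w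
  permutation-injective eq =
    trans (sym (inverseˡ π)) (trans (cong (π ⟨$⟩ˡ_) eq) (inverseˡ π))

  hat-letterAt : ∀ s → hat π ⟨$⟩ʳ (w s) ≡ w (cycleStep w s)
  hat-letterAt s = cong (w ∘ cycleStep w) (inverseˡ π)

  module _ {s s′ v : Fin n} (ws′<wv : w s′ Fin.< w v) (v≤ : v Fin.≤ s ⊎ v Fin.≤ s′) where

    hat≡⇒adjacent : hat π ⟨$⟩ʳ (w s) ≡ w s′ → toℕ s′ ≡ suc (toℕ s)
    hat≡⇒adjacent eq = cycleStep≡⇒adjacent w ws′<wv v≤
      (permutation-injective (trans (sym (hat-letterAt s)) eq))

    adjacent⇒hat≡ : toℕ s′ ≡ suc (toℕ s) → hat π ⟨$⟩ʳ (w s) ≡ w s′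
    adjacent⇒hat≡ adj =
      trans (hat-letterAt s) (cong w (adjacent⇒cycleStep≡ w ws′<wv v≤ adj))

-- Arrow occurrences against vincular occurrences.

module _ {m} (ν : Vector (Fin (suc m)) m) (ν-inj : Injective _≡_ _≡_ ν)
  {r : Fin (suc m)} (r∉ν : ∀ j → ν j ≢ r)
  {i : Fin m} {p : Fin (suc m)} (p-next : NextTo i p) where

  private
    σ : Vector (Fin (suc m)) (suc m)
    σ = insertAt ν p r

    σ-inj : Injective _≡_ _≡_ σ
    σ-inj = insertAt-injective ν-inj r∉ν p

    at : Fin (suc m) → Fin (suc m)
    at a = proj₁ (injective⇒surjective σ-inj a)

    σ-at : ∀ a → σ (at a) ≡ a
    σ-at a = proj₂ (injective⇒surjective σ-inj a)

  -- For `p` equal to `inject₁ i` or `suc i` this is definitionally `overlineBefore` or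
  -- `overlineAfter`, so results about it apply to both without transport.
  overlineNextTo : VincularPattern m
  overlineNextTo = record { word = σ ; distinct = σ-inj ; overlined = ⁅ i ⁆ }

  module _ {b c} (σi≡b : σ (inject₁ i) ≡ b) (σ1+i≡c : σ (suc i) ≡ c) (r∈bc : r ≡ b ⊎ r ≡ c)
    {j} (j<i : j Fin.< i) (c<νj : c Fin.< ν j) {n} (π : Permutation′ n) where

    private
      w : Vector (Fin n) n
      w = π ⟨$⟩ʳ_

      -- Monotonicity is assumed only away from `p`, because the place of the inserted position is
      -- still unknown when adjacency is being derived. The letter `ν j` can thus be compared only
      -- with `ν i`, which stands at `suc i` in part (i) and at `inject₁ i` in part (ii); hence the
      -- disjunction.
      larger-earlier : ∀ {t : Vector (Fin n) (suc m)} → Increasing (t ∘ punchIn p) →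
                       t (punchIn p j) Fin.≤ t (inject₁ i) ⊎ t (punchIn p j) Fin.≤ t (suc i)
      larger-earlier {t} t-inc with punchIn p i | punchIn-nextTo p-next | t-inc j<i
      ... | _ | inj₁ refl | lt = inj₁ (ℕ.<⇒≤ lt)
      ... | _ | inj₂ refl | lt = inj₂ (ℕ.<⇒≤ lt)

      descent : ∀ {x : Fin (suc m) → Fin n} {t : Vector (Fin n) (suc m)} →
                Increasing x → (∀ a → w (t a) ≡ x (σ a)) →
                w (t (suc i)) Fin.< w (t (punchIn p j))
      descent {x} {t} x-inc wt≡xσ =
        subst₂ Fin._<_ (sym (trans (wt≡xσ _) (cong x σ1+i≡c)))
          (sym (trans (wt≡xσ _) (cong x (insertAt-punchIn ν p r j)))) (x-inc c<νj)

    arrow⇒vincular : ContainsArrow (oneArrow ν ν-inj r∉ν b c r∈bc) π →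
                     ContainsVincular overlineNextTo π
    arrow⇒vincular (x , t , x-inc , t-inc , wt≡xν , hat-arrow ∷ []) =
      t′ , insertAt-nextTo-increasing p-next t-inc u∉t adj , iso ,
      λ k k∈ → subst (λ k → toℕ (t′ (suc k)) ≡ suc (toℕ (t′ (inject₁ k))))
        (sym (x∈⁅y⁆⇒x≡y i k∈)) adj
      where
      -- The one letter of the occurrence missing from the word is `x r`; its position in `π` is the
      -- one to insert.
      u : Fin n
      u = π ⟨$⟩ˡ x r

      t′ : Vector (Fin n) (suc m)
      t′ = insertAt t p u

      wt′≡xσ : ∀ a → w (t′ a) ≡ x (σ a)
      wt′≡xσ a with p Fin.≟ a
      ... | yes refl = trans (cong w (insertAt-lookup t p u))
        (trans (inverseʳ π) (cong x (sym (insertAt-lookup ν p r))))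
      ... | no p≢a = trans (cong w (insertAt-other t p u p≢a))
        (trans (wt≡xν _) (cong x (sym (insertAt-other ν p r p≢a))))

      u∉t : ∀ j → t j ≢ u
      u∉t j tj≡u = r∉ν j (increasing⇒injective x-inc
        (trans (sym (wt≡xν j)) (trans (cong w tj≡u) (inverseʳ π))))

      t′-inc : Increasing (t′ ∘ punchIn p)
      t′-inc {k} {l} k<l = subst₂ Fin._<_
        (sym (insertAt-punchIn t p u k)) (sym (insertAt-punchIn t p u l)) (t-inc k<l)

      -- Adjacency comes first, from the arrow alone; that `t′` increases is deduced from it.
      adj : toℕ (t′ (suc i)) ≡ suc (toℕ (t′ (inject₁ i)))
      adj = hat≡⇒adjacent π (descent x-inc wt′≡xσ) (larger-earlier {t′} t′-inc) (begin
        hat π ⟨$⟩ʳ w (t′ (inject₁ i)) ≡⟨ cong (hat π ⟨$⟩ʳ_) (wt′≡xσ _) ⟩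
        hat π ⟨$⟩ʳ x (σ (inject₁ i))  ≡⟨ cong (λ a → hat π ⟨$⟩ʳ x a) σi≡b ⟩
        hat π ⟨$⟩ʳ x b                ≡⟨ hat-arrow ⟩
        x c                           ≡⟨ cong x σ1+i≡c ⟨
        x (σ (suc i))                 ≡⟨ wt′≡xσ _ ⟨
        w (t′ (suc i))                ∎)
        where open ≡-Reasoning

      iso : OrderIsomorphic σ (w ∘ t′)
      iso a b = mk⇔
        (λ lt → subst₂ Fin._<_ (sym (wt′≡xσ a)) (sym (wt′≡xσ b)) (x-inc lt))
        (λ lt → increasing⇒reflects-< x-inc (subst₂ Fin._<_ (wt′≡xσ a) (wt′≡xσ b) lt))

    vincular⇒arrow : ContainsVincular overlineNextTo π →
                     ContainsArrow (oneArrow ν ν-inj r∉ν b c r∈bc) π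
    vincular⇒arrow (t , t-inc , iso , overline) =
      x , t ∘ punchIn p , x-inc , t-inc ∘ punchIn-increasing p , wt≡xν , hat-arrow ∷ []
      where
      -- An arrow occurrence indexes its letters by value, a vincular one by position; `at`, the
      -- inverse of `σ`, converts between them.
      x : Fin (suc m) → Fin n
      x a = w (t (at a))

      x-inc : Increasing x
      x-inc a<b = Equivalence.to (iso _ _) (subst₂ Fin._<_ (sym (σ-at _)) (sym (σ-at _)) a<b)

      wt≡xσ : ∀ a → w (t a) ≡ x (σ a)
      wt≡xσ a = cong (w ∘ t) (sym (σ-inj (σ-at (σ a))))

      wt≡xν : ∀ k → w (t (punchIn p k)) ≡ x (ν k)
      wt≡xν k = trans (wt≡xσ _) (cong x (insertAt-punchIn ν p r k))

      hat-arrow : hat π ⟨$⟩ʳ x b ≡ x c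
      hat-arrow = begin
        hat π ⟨$⟩ʳ x b                 ≡⟨ cong (λ a → hat π ⟨$⟩ʳ x a) σi≡b ⟨
        hat π ⟨$⟩ʳ x (σ (inject₁ i))   ≡⟨ cong (hat π ⟨$⟩ʳ_) (wt≡xσ _) ⟨
        hat π ⟨$⟩ʳ w (t (inject₁ i))   ≡⟨ adjacent⇒hat≡ π (descent x-inc wt≡xσ)
                                            (larger-earlier {t} (t-inc ∘ punchIn-increasing p))
                                            (overline i (x∈⁅x⁆ i)) ⟩
        w (t (suc i))                  ≡⟨ wt≡xσ _ ⟩
        x (σ (suc i))                  ≡⟨ cong x σ1+i≡c ⟩
        x c                            ∎
        where open ≡-Reasoning

  -- The hypotheses of (i) and (ii) enter only as a letter before `ν i` exceeding the target `c` of
  -- the arrow.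
  arrow≐vincular : ∀ {b c} → σ (inject₁ i) ≡ b → σ (suc i) ≡ c → (r∈bc : r ≡ b ⊎ r ≡ c) →
                   (∃ λ j → j Fin.< i × c Fin.< ν j) → ∀ n →
                   𝒮ᵃ n (oneArrow ν ν-inj r∉ν b c r∈bc) ≐ 𝒮ᵛ n overlineNextTo
  arrow≐vincular σi≡b σ1+i≡c r∈bc (j , j<i , c<νj) n =
    (λ {π} avoids → avoids ∘ vincular⇒arrow σi≡b σ1+i≡c r∈bc j<i c<νj π) ,
    (λ {π} avoids → avoids ∘ arrow⇒vincular σi≡b σ1+i≡c r∈bc j<i c<νj π)

-- The larger earlier letter supplied by each hypothesis.

∉Lmax⇒larger-before : ∀ {m k} (w : Vector (Fin k) m) → Injective _≡_ _≡_ w → ∀ {i} →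
                      w i ∉ Lmax w → ∃ λ j → j Fin.< i × w i Fin.< w j
∉Lmax⇒larger-before w w-inj {i} wi∉ with ¬IsLRMax⇒∃≥ w (λ i-max → wi∉ (i , refl , i-max))
-- Injectivity makes the weak bound strict.
... | j , j<i , wi≤wj = j , j<i , Fin.≤∧≢⇒< wi≤wj (Fin.<⇒≢ j<i ∘ sym ∘ w-inj)

take-tabulate⁺ : ∀ {P : ℕ → Set} {n} (f : Fin n → ℕ) k → (∀ j → toℕ j < k → P (f j)) →
                 All P (take k (tabulate f))
take-tabulate⁺             f zero    Pf = []
take-tabulate⁺ {n = zero}  f (suc k) Pf = []
take-tabulate⁺ {n = suc _} f (suc k) Pf =
  Pf zero ℕ.z<s ∷ take-tabulate⁺ (f ∘ suc) k (λ j → Pf (suc j) ∘ s<s)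

<maxBefore⇒larger-before : ∀ {m k} (w : Vector (Fin k) m) {r : Fin k} {i} →
                           toℕ r < maxBefore w i → ∃ λ j → j Fin.< i × r Fin.< w j
<maxBefore⇒larger-before w {r} {i} r<max
  with any? (λ j → (j Fin.<? i) ×-dec (r Fin.<? w j))
... | yes found = found
-- Otherwise `r` bounds every letter before `i`, hence their maximum; `z≤n` covers its default value
-- 0.
... | no none   = contradiction
  (max≤v⁺ z≤n (take-tabulate⁺ (toℕ ∘ w) (toℕ i) λ j j<i → ℕ.≮⇒≥ λ r<wj → none (j , j<i , r<wj)))
  (ℕ.<⇒≱ r<max)

lemma2p2 : ∀ {m : ℕ} (ν : Vector (Fin (suc m)) m) (ν-inj : Injective _≡_ _≡_ ν)
    (r : Fin (suc m)) (r∉ν : ∀ j → ν j ≢ r) (i : Fin m) (n : ℕ) → n ≥ 1 →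
    (ν i ∉ Lmax ν →
    𝒮ᵃ n (oneArrow ν ν-inj r∉ν r (ν i) (inj₁ refl)) ≐ 𝒮ᵛ n (overlineBefore ν r ν-inj r∉ν i))
    ×
    (toℕ r < maxBefore ν i →
    𝒮ᵃ n (oneArrow ν ν-inj r∉ν (ν i) r (inj₂ refl)) ≐ 𝒮ᵛ n (overlineAfter ν r ν-inj r∉ν i))
lemma2p2 ν ν-inj r r∉ν i n _ =
  (λ νi∉Lmax → arrow≐vincular ν ν-inj r∉ν (inj₁ refl)
    (insertAt-lookup ν (inject₁ i) r) (insertAt-inject₁-suc ν i r)
    (inj₁ refl) (∉Lmax⇒larger-before ν ν-inj νi∉Lmax) n) ,
  (λ r<max → arrow≐vincular ν ν-inj r∉ν (inj₂ refl)
    (insertAt-suc-inject₁ ν i r) (insertAt-lookup ν (suc i) r)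
    (inj₂ refl) (<maxBefore⇒larger-before ν r<max) n)
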